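{- For all integers $m \ge 0$, $n \ge 1$, $k \ge 0$, the $m$-nested summation $S^{(m)}(n,k)$ of the $k$-th power of the first $n$ natural numbers is given by $$S^{(m)}(n,k) = \sum_{i=0}^{k} \binom{n+m-1}{m+i}\, \mu(k,i).$$
   Context: Nested summation: for integers $m \ge 0$, $n \ge 1$, $k \ge 0$, define $S^{(m)}(n,k)$ (written $\sum^{(m)} n^k$ in the source) recursively by $S^{(0)}(n,k) = n^k$ and, for $m \ge 1$, $S^{(m)}(n,k) = \sum_{j=1}^{n} S^{(m-1)}(j,k)$. Saras triangle: for integers $k \ge 0$, $r \ge 0$, define $\mu(k,r)$ (the entry in row $k$, column $r$, both numbered from $0$) by $\mu(k,r) = 1$ if $r = 0$; $\mu(k,r) = r\,\mu(k-1,r-1) + (r+1)\,\mu(k-1,r)$ if $1 \le r \le k$; and $\mu(k,r) = 0$ if $r > k$. Binomial coefficients $\binom{a}{b}$ with integers $0 \le a < b$ are $0$. -}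

module Defs where

open import Data.Bool using (if_then_else_)
open import Data.List using (applyUpTo)
open import Data.Nat using (ℕ; zero; suc; _+_; _*_; _^_; _≤ᵇ_)
open import Data.Nat.ListAction using (sum)

∑< : ℕ → (ℕ → ℕ) → ℕ
∑< n f = sum (applyUpTo f n)

infix 5 ∑<
syntax ∑< n (λ i → e) = ∑[ i < n ] e

-- S m n k is the m-nested sum S^(m)(n,k). The summation index 1 ≤ j ≤ n
-- is written suc j with j < n, so only positive arguments are ever summed.
S : (m n k : ℕ) → ℕ
S zero    n k = n ^ k
S (suc m) n k = ∑[ j < n ] S m (suc j) k

-- μ k r is the entry of the Saras triangle in row k, column r (both from 0).
-- The last clause is the recurrence with column r + 1 in place of r; its
-- else-branch, like the second clause, covers columns beyond the row number.
μ : (k r : ℕ) → ℕ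
μ k       zero    = 1
μ zero    (suc r) = 0
μ (suc k) (suc r) =
  if suc r ≤ᵇ suc k
  then suc r * μ k r + suc (suc r) * μ k (suc r)
  else 0

{-# OPTIONS --safe #-}

-- For m = 0, induct on k. Writing n = p + 1, absorption and Pascal's rule give
--   (p + 1) C(p, i) = (i + 1) C(p, i) + (i + 1) C(p, i + 1),
-- so collecting the coefficient of each C(p, i) in (p + 1) · (p + 1)^k yields
-- exactly the recurrence of the Saras triangle. Each further summation over n
-- is then the hockey-stick identity applied term by term.

module Submission where

open import Defs
open import Data.Bool using (true; false; T)
open import Data.List using (applyUpTo; [_]; _∷ʳ_)
open import Data.List.Properties using (applyUpTo-∷ʳ)
open import Data.Nat using (ℕ; zero; suc; _+_; _*_; _∸_; _^_; _≤_; _<_; _<ᵇ_; s≤s)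
open import Data.Nat.Combinatorics
  using (_C_; k>n⇒nCk≡0; nC1≡n; nCk+nC[k+1]≡[n+1]C[k+1])
open import Data.Nat.ListAction using (sum)
open import Data.Nat.ListAction.Properties using (sum-++)
open import Data.Nat.Properties
open import Data.Nat.Tactic.RingSolver using (solve-∀)
open import Function using (_∘_)
open import Relation.Binary.PropositionalEquality
  using (_≡_; refl; sym; trans; cong; cong₂; subst; module ≡-Reasoning)

open ≡-Reasoning

∑-cong : ∀ n {f g : ℕ → ℕ} → (∀ i → f i ≡ g i) → ∑< n f ≡ ∑< n g
∑-cong zero    f≗g = refl
∑-cong (suc n) f≗g = cong₂ _+_ (f≗g 0) (∑-cong n (f≗g ∘ suc))

∑-zero : ∀ n {f : ℕ → ℕ} → (∀ i → f i ≡ 0) → ∑< n f ≡ 0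
∑-zero zero    f≗0 = refl
∑-zero (suc n) f≗0 = cong₂ _+_ (f≗0 0) (∑-zero n (f≗0 ∘ suc))

∑-+ : ∀ n (f g : ℕ → ℕ) → ∑< n (λ i → f i + g i) ≡ ∑< n f + ∑< n g
∑-+ zero    f g = refl
∑-+ (suc n) f g = trans
  (cong (f 0 + g 0 +_) (∑-+ n (f ∘ suc) (g ∘ suc)))
  (interchange (f 0) (g 0) _ _)
  where
  interchange : ∀ a b c d → a + b + (c + d) ≡ a + c + (b + d)
  interchange = solve-∀

*-distribˡ-∑ : ∀ c n (f : ℕ → ℕ) → c * ∑< n f ≡ ∑< n (λ i → c * f i)
*-distribˡ-∑ c zero    f = *-zeroʳ c
*-distribˡ-∑ c (suc n) f = trans
  (*-distribˡ-+ c (f 0) _)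
  (cong (c * f 0 +_) (*-distribˡ-∑ c n (f ∘ suc)))

∑-last : ∀ n (f : ℕ → ℕ) → ∑< (suc n) f ≡ ∑< n f + f n
∑-last n f = begin
  sum (applyUpTo f (suc n))             ≡⟨ cong sum (applyUpTo-∷ʳ f n) ⟨
  sum (applyUpTo f n ∷ʳ f n)            ≡⟨ sum-++ (applyUpTo f n) [ f n ] ⟩
  ∑< n f + (f n + 0)                    ≡⟨ cong (∑< n f +_) (+-identityʳ (f n)) ⟩
  ∑< n f + f n                          ∎

-- A vanishing term just past the end may be appended, so splitting off the first term keeps the
-- length `n`. This lets two sums of equal length be added after one has been shifted.
∑-shift : ∀ n (f : ℕ → ℕ) → f n ≡ 0 → ∑< n f ≡ f 0 + ∑< n (f ∘ suc)
∑-shift n f fn≡0 = begin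
  ∑< n f        ≡⟨ +-identityʳ _ ⟨
  ∑< n f + 0    ≡⟨ cong (∑< n f +_) fn≡0 ⟨
  ∑< n f + f n  ≡⟨ ∑-last n f ⟨
  ∑< (suc n) f  ∎

C-absorption : ∀ n k → suc k * (suc n C suc k) ≡ suc n * (n C k)
C-absorption zero    zero    = refl
C-absorption zero    (suc k) = *-zeroʳ (suc (suc k))
C-absorption (suc n) zero    = begin
  1 * (suc (suc n) C 1)  ≡⟨ *-identityˡ _ ⟩
  suc (suc n) C 1        ≡⟨ nC1≡n (suc (suc n)) ⟩
  suc (suc n)            ≡⟨ *-identityʳ _ ⟨
  suc (suc n) * 1        ∎
C-absorption (suc n) (suc k) = begin
  suc (suc k) * (suc (suc n) C suc (suc k))
    ≡⟨ cong (suc (suc k) *_) (nCk+nC[k+1]≡[n+1]C[k+1] (suc n) (suc k)) ⟨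
  suc (suc k) * (c + (suc n C suc (suc k)))
    -- `suc (suc k) * c` unfolds to `c + suc k * c`; setting the spare `c` aside leaves two products
    -- that match the induction hypothesis at `k` and at `suc k`.
    ≡⟨ *-distribˡ-+ (suc (suc k)) c _ ⟩
  c + suc k * c + suc (suc k) * (suc n C suc (suc k))
    ≡⟨ cong₂ (λ x y → c + x + y) (C-absorption n k) (C-absorption n (suc k)) ⟩
  c + suc n * (n C k) + suc n * (n C suc k)
    ≡⟨ +-assoc c _ _ ⟩
  c + (suc n * (n C k) + suc n * (n C suc k))
    ≡⟨ cong (c +_) (*-distribˡ-+ (suc n) (n C k) (n C suc k)) ⟨
  c + suc n * ((n C k) + (n C suc k))
    ≡⟨ cong (λ x → c + suc n * x) (nCk+nC[k+1]≡[n+1]C[k+1] n k) ⟩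
  suc (suc n) * c ∎
  where c = suc n C suc k

-- Trades the factor `suc n` for coefficients depending on `k` alone, as the Saras recurrence
-- requires.
[1+n]*nCk : ∀ n k → suc n * (n C k) ≡ suc k * (n C k) + suc k * (n C suc k)
[1+n]*nCk n k = begin
  suc n * (n C k)                        ≡⟨ C-absorption n k ⟨
  suc k * (suc n C suc k)                ≡⟨ cong (suc k *_) (nCk+nC[k+1]≡[n+1]C[k+1] n k) ⟨
  suc k * ((n C k) + (n C suc k))        ≡⟨ *-distribˡ-+ (suc k) (n C k) (n C suc k) ⟩
  suc k * (n C k) + suc k * (n C suc k)  ∎

r>k⇒μ≡0 : ∀ {k r} → k < r → μ k r ≡ 0
r>k⇒μ≡0 {zero}  {suc r} _ = refl
r>k⇒μ≡0 {suc k} {suc r} (s≤s k<r) with r <ᵇ suc k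
... | false = refl
-- This branch contradicts `k < r`, but need not be refuted: both entries in the recurrence vanish
-- by induction.
... | true  rewrite r>k⇒μ≡0 k<r | r>k⇒μ≡0 (m<n⇒m<1+n k<r)
                  | *-zeroʳ r = refl

μ-rec : ∀ k r → μ (suc k) (suc r) ≡ suc r * μ k r + suc (suc r) * μ k (suc r)
μ-rec k r with r <ᵇ suc k in eq
... | true  = refl
... | false = sym (cong₂ _+_
  (trans (cong (suc r *_) (r>k⇒μ≡0 k<r)) (*-zeroʳ (suc r)))
  (trans (cong (suc (suc r) *_) (r>k⇒μ≡0 (m<n⇒m<1+n k<r))) (*-zeroʳ (suc (suc r)))))
  where
  k<r : k < r
  k<r = ≮⇒≥ λ r<1+k → subst T eq (<⇒<ᵇ r<1+k)

[1+p]^k≡∑ : ∀ k p → suc p ^ k ≡ (∑[ i < suc k ] (p C i) * μ k i)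
[1+p]^k≡∑ zero    p = refl
[1+p]^k≡∑ (suc k) p = begin
  suc p * suc p ^ k
    ≡⟨ cong (suc p *_) ([1+p]^k≡∑ k p) ⟩
  suc p * ∑< (suc k) (λ i → (p C i) * μ k i)
    ≡⟨ *-distribˡ-∑ (suc p) (suc k) (λ i → (p C i) * μ k i) ⟩
  ∑< (suc k) (λ i → suc p * ((p C i) * μ k i))
    ≡⟨ ∑-cong (suc k) split ⟩
  ∑< (suc k) (λ i → f i + g i)
    ≡⟨ ∑-+ (suc k) f g ⟩
  ∑< (suc k) f + ∑< (suc k) g
    ≡⟨ cong (_+ ∑< (suc k) g) (∑-shift (suc k) f f[1+k]≡0) ⟩
  f 0 + ∑< (suc k) (f ∘ suc) + ∑< (suc k) g
    ≡⟨ +-assoc (f 0) (∑< (suc k) (f ∘ suc)) (∑< (suc k) g) ⟩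
  f 0 + (∑< (suc k) (f ∘ suc) + ∑< (suc k) g)
    ≡⟨ cong (f 0 +_) (∑-+ (suc k) (f ∘ suc) g) ⟨
  -- `f 0` computes to 1, which is the column 0 term of the new row.
  1 + ∑< (suc k) (λ i → f (suc i) + g i)
    ≡⟨ cong suc (∑-cong (suc k) merge) ⟩
  ∑< (suc (suc k)) (λ i → (p C i) * μ (suc k) i) ∎
  where
  -- `f i` is the part of term `i` that stays with `p C i`; `g i` is the part that moves on to
  -- `p C suc i`.
  f g : ℕ → ℕ
  f i = suc i * (p C i) * μ k i
  g i = suc i * (p C suc i) * μ k i

  split : ∀ i → suc p * ((p C i) * μ k i) ≡ f i + g i
  split i = begin
    suc p * ((p C i) * μ k i)                          ≡⟨ *-assoc (suc p) (p C i) _ ⟨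
    suc p * (p C i) * μ k i                            ≡⟨ cong (_* μ k i) ([1+n]*nCk p i) ⟩
    (suc i * (p C i) + suc i * (p C suc i)) * μ k i    ≡⟨ *-distribʳ-+ (μ k i) (suc i * (p C i)) _ ⟩
    f i + g i                                          ∎

  f[1+k]≡0 : f (suc k) ≡ 0
  f[1+k]≡0 = trans
    (cong (suc (suc k) * (p C suc k) *_) (r>k⇒μ≡0 (n<1+n k)))
    (*-zeroʳ (suc (suc k) * (p C suc k)))

  regroup : ∀ a b c x y → b * c * y + a * c * x ≡ c * (a * x + b * y)
  regroup = solve-∀

  merge : ∀ i → f (suc i) + g i ≡ (p C suc i) * μ (suc k) (suc i)
  merge i = trans
    (regroup (suc i) (suc (suc i)) (p C suc i) (μ k i) (μ k (suc i)))
    (cong ((p C suc i) *_) (sym (μ-rec k i)))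

-- Declared ahead of `S-positive` for mutual recursion, which descends in `m`. Allowing `n = 0`
-- starts the induction on `n` at the empty sum, where every binomial has lower index above the
-- upper one; each further `n` costs one use of Pascal's rule per term.
S-suc : ∀ m n k → S (suc m) n k ≡ (∑[ i < suc k ] ((n + m) C (suc m + i)) * μ k i)

S-positive : ∀ m p k → S m (suc p) k ≡ (∑[ i < suc k ] ((p + m) C (m + i)) * μ k i)
S-positive zero    p k rewrite +-identityʳ p = [1+p]^k≡∑ k p
S-positive (suc m) p k rewrite +-suc p m = S-suc m (suc p) k

S-suc m zero    k = sym (∑-zero (suc k) λ i →
  cong (_* μ k i) (k>n⇒nCk≡0 (s≤s (m≤m+n m i))))
S-suc m (suc n) k = begin
  S (suc m) (suc n) k
    ≡⟨ ∑-last n (λ j → S m (suc j) k) ⟩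
  S (suc m) n k + S m (suc n) k
    ≡⟨ cong₂ _+_ (S-suc m n k) (S-positive m n k) ⟩
  ∑< (suc k) upper + ∑< (suc k) lower
    ≡⟨ ∑-+ (suc k) upper lower ⟨
  ∑< (suc k) (λ i → upper i + lower i)
    ≡⟨ ∑-cong (suc k) pascal ⟩
  ∑< (suc k) (λ i → ((suc n + m) C (suc m + i)) * μ k i) ∎
  where
  upper lower : ℕ → ℕ
  upper i = ((n + m) C (suc m + i)) * μ k i
  lower i = ((n + m) C (m + i)) * μ k i

  pascal : ∀ i → upper i + lower i ≡ ((suc n + m) C (suc m + i)) * μ k i
  pascal i = begin
    upper i + lower i
      ≡⟨ +-comm (upper i) (lower i) ⟩
    lower i + upper i
      ≡⟨ *-distribʳ-+ (μ k i) ((n + m) C (m + i)) _ ⟨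
    (((n + m) C (m + i)) + ((n + m) C (suc m + i))) * μ k i
      ≡⟨ cong (_* μ k i) (nCk+nC[k+1]≡[n+1]C[k+1] (n + m) (m + i)) ⟩
    ((suc n + m) C (suc m + i)) * μ k i ∎

mainTheorem1 : (m n k : ℕ) → 1 ≤ n →
    S m n k ≡ (∑[ i < suc k ] ((n + m ∸ 1) C (m + i)) * μ k i)
-- With `n = suc p`, the truncated `n + m ∸ 1` computes to `p + m`.
mainTheorem1 m (suc p) k _ = S-positive m p k
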